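{- Let $\langle X,\mathcal{K},T\rangle$ be a MoS-space. Then the following hold: 1. $T=T_{R_T}$; 2. $m_{R_T}=\Box_T$ (as maps on $S(X)$).
   Context: **S-spaces.** Let $X$ be a set and $\mathcal{K}\subseteq\mathcal{P}(X)$, regarded as a subbase of a topology on $X$. Put $S(X)=\{U^c: U\in\mathcal{K}\}$ and $\mathcal{C}_{\mathcal{K}}(X)=\{\bigcap\mathcal{A}:\mathcal{A}\subseteq S(X)\}$ (with $\bigcap\emptyset=X$). For $Y\subseteq X$, a family $\mathcal{J}\subseteq S(X)$ is a $Y$-family if for all $A,B\in\mathcal{J}$ there are $H\in S(X)$, $C\in\mathcal{J}$ with $Y\subseteq H$, $A\cap H\subseteq C$ and $B\cap H\subseteq C$. $\langle X,\mathcal{K}\rangle$ is an S-space if: (S1) the topology is $T_0$ and $X=\bigcup\mathcal{K}$; (S2) $\mathcal{K}$ is a subbase of compact open sets, closed under finite unions, and $\emptyset\in\mathcal{K}$; (S3) if $x\in U\cap V$ with $U,V\in\mathcal{K}$, there are $W,D\in\mathcal{K}$ with $x\notin W$, $x\in D$, $D\subseteq(U\cap V)\cup W$; (S4) if $Y\in\mathcal{C}_{\mathcal{K}}(X)$ and $\mathcal{J}\subseteq S(X)$ is a $Y$-family with $Y\cap A^c\neq\emptyset$ for all $A\in\mathcal{J}$, then $Y\cap\bigcap\{A^c:A\in\mathcal{J}\}\neq\emptyset$. Then $\mathbf{S}(X)=\langle S(X),\cap,X\rangle$ is a meet-semilattice with greatest element. For $T\subseteq X\times X$ write $T(x)=\{y:(x,y)\in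 T\}$, $\Box_T(U)=\{x:T(x)\subseteq U\}$. $T$ is a meet-relation if $\Box_T(U)\in S(X)$ for all $U\in S(X)$ and $T(x)=\bigcap\{U\in S(X):T(x)\subseteq U\}$ for all $x$. A MoS-space is $\langle X,\mathcal{K},T\rangle$ with $\langle X,\mathcal{K}\rangle$ an S-space and $T\subseteq X\times X$ a meet-relation. $\mathcal{Z}(X)$ is the set of all $Z=\bigcap\mathcal{L}$ with $\mathcal{L}\subseteq\mathcal{K}$ non-empty and dually directed under $\subseteq$. For $U\in S(X)$, $L_U=\{Z\in\mathcal{Z}(X):Z\cap U\neq\emptyset\}$; for $R\subseteq X\times\mathcal{Z}(X)$ and $U\in S(X)$, $m_R(U)=\{x\in X:R(x)\subseteq L_U\}$. For a semilattice $\mathbf{A}$, $\mathcal{X}(\mathbf{A})$ is the set of irreducible filters (proper filters $F$ such that $F=F_1\cap F_2$ with $F_1,F_2$ filters implies $F=F_1$ or $F=F_2$), $\beta_{\mathbf{A}}(a)=\{P\in\mathcal{X}(\mathbf{A}):a\in P\}$, and $\mathcal{K}_{\mathbf{A}}=\{\beta_{\mathbf{A}}(a)^c:a\in A\}$; $\langle\mathcal{X}(\mathbf{A}),\mathcal{K}_{\mathbf{A}}\rangle$ is an S-space. For a monotone $m:A\to A$, $R_m\subseteq\mathcal{X}(\mathbf{A})\times\mathcal{Z}(\mathcal{X}(\mathbf{A}))$ is given by $(P,Z)\in R_m\iff m^{ -1}[P]\cap I_{\mathbf{A}}(Z)=\emptyset$, where $I_{\mathbf{A}}(Z)=\{a\in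 A:\beta_{\mathbf{A}}(a)\cap Z=\emptyset\}$. For $m:A\to A$, $N_m\subseteq\mathcal{X}(\mathbf{A})\times\mathcal{X}(\mathbf{A})$ is given by $(P,Q)\in N_m\iff m^{ -1}[P]\subseteq Q$. For an S-space, $H_X:X\to\mathcal{X}(\mathbf{S}(X))$, $H_X(x)=\{A\in S(X):x\in A\}$, is a homeomorphism. For a meet-relation $T$ on $X$, the multirelation $R_T\subseteq X\times\mathcal{Z}(X)$ is defined by $(x,Z)\in R_T\iff(H_X(x),H_X[Z])\in R_{\Box_T}$. For a multirelation $R\subseteq X\times\mathcal{Z}(X)$ with $m_R(U)\in S(X)$ for all $U\in S(X)$, the relation $T_R\subseteq X\times X$ is defined by $(x,y)\in T_R\iff(H_X(x),H_X(y))\in N_{m_R}$. -}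

module Defs where

open import Algebra.Lattice.Bundles using (BoundedMeetSemilattice)
import Algebra.Lattice.Properties.Semilattice as SemilatticeProperties
open import Axiom.ExcludedMiddle using (ExcludedMiddle)
open import Data.List.Base using (List)
open import Data.List.Relation.Unary.All using (All)
open import Data.List.Relation.Unary.Any using (Any)
open import Data.Product.Base using (_×_; _,_; ∃; ∃-syntax; Σ-syntax; proj₁; proj₂)
open import Data.Sum.Base using (_⊎_; inj₁; inj₂; [_,_]′)
open import Function.Base using (_∘_; _on_; id)
open import Level using (Level; _⊔_; suc; Lift; lift; lower)
open import Relation.Binary.Core using (Rel; REL)
open import Relation.Binary.Definitions using (_Respects_)
open import Relation.Binary.PropositionalEquality.Core using (_≢_)
import Relation.Binary.Construct.On as On
open import Relation.Nullary.Decidable.Core using (yes; no; decidable-stable)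
open import Relation.Nullary.Negation.Core using (¬_; contradiction)
open import Relation.Unary
  using (Pred; _∈_; _∉_; _⊆_; _≐_; _∩_; _∪_; ∁; _⊢_; _≬_; Empty; Satisfiable; Universal)
open import Relation.Unary.Polymorphic using (∅; U)
open import Relation.Unary.Relation.Binary.Equality using (≐-isEquivalence)

private
  variable
    v w : Level

-- Subsets are predicates and are compared by _≐_, at possibly different
-- universe levels.  Under excluded middle (a hypothesis of Duality below) a
-- predicate of any level is ≐ to one of any chosen level, so the levels fixed
-- below are not a restriction.  Families of subsets of X live at the least
-- level containing both X and the type of subsets of X.

module Subbase {x u : Level} (X : Set x) where

  Subset : Set (x ⊔ suc u)
  Subset = Pred X u

  Family : Set (suc (x ⊔ suc u))
  Family = Pred Subset (x ⊔ suc u)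

  ⋂ᶠ : Pred Subset w → Pred X (x ⊔ suc u ⊔ w)
  ⋂ᶠ 𝒜 y = ∀ A → A ∈ 𝒜 → y ∈ A

  ⋃ᶠ : Pred Subset w → Pred X (x ⊔ suc u ⊔ w)
  ⋃ᶠ 𝒜 y = ∃[ A ] A ∈ 𝒜 × y ∈ A

  ⋂ˡ ⋃ˡ : List Subset → Pred X (x ⊔ suc u)
  ⋂ˡ As y = All (y ∈_) As
  ⋃ˡ As y = Any (y ∈_) As

  module _ (K : Family) where

    -- Open sets of the topology generated by K: unions of finite
    -- intersections of members of K.
    Open : Pred X v → Set (x ⊔ suc u ⊔ v)
    Open O = ∀ {y} → y ∈ O → ∃[ Us ] All (_∈ K) Us × y ∈ ⋂ˡ Us × ⋂ˡ Us ⊆ O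

    Compact : Pred X v → Set (suc (x ⊔ suc u) ⊔ v)
    Compact C = (𝒪 : Family) → (∀ O → O ∈ 𝒪 → Open O) → C ⊆ ⋃ᶠ 𝒪 →
                ∃[ Os ] All (_∈ 𝒪) Os × C ⊆ ⋃ˡ Os

    S : Pred (Pred X v) (x ⊔ suc u ⊔ v)
    S A = ∃[ V ] V ∈ K × A ≐ ∁ V

    𝒞 : Pred (Pred X v) (suc (x ⊔ suc u) ⊔ v)
    𝒞 Y = Σ[ 𝒜 ∈ Family ] 𝒜 ⊆ S × Y ≐ ⋂ᶠ 𝒜

    -- Y-families are non-empty.  If 𝒥 = ∅ were allowed, S4 applied to
    -- Y = ⋂ S(X) = (⋃ K)ᶜ = ∅ would be false, so there would be no S-spaces.
    record IsYFamily (Y : Pred X v) (𝒥 : Family) : Set (x ⊔ suc u ⊔ v) where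
      field
        ⊆S       : 𝒥 ⊆ S
        nonEmpty : Satisfiable 𝒥
        directed : ∀ A B → A ∈ 𝒥 → B ∈ 𝒥 →
                   Σ[ H ∈ Subset ] Σ[ C ∈ Subset ]
                   H ∈ S × C ∈ 𝒥 × Y ⊆ H × A ∩ H ⊆ C × B ∩ H ⊆ C

    record IsSSpace : Set (suc (x ⊔ suc u)) where
      field
        K-resp-≐  : K Respects _≐_
        T₀        : ∀ a b → a ≢ b → Σ[ O ∈ Subset ]
                    Open O × ((a ∈ O × b ∉ O) ⊎ (b ∈ O × a ∉ O))
        covers    : Universal (⋃ᶠ K)
        K-compact : ∀ V → V ∈ K → Compact V
        ∪-closed  : ∀ V W → V ∈ K → W ∈ K → V ∪ W ∈ K
        ∅∈K       : ∅ ∈ K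
        S3        : ∀ {a} V V′ → V ∈ K → V′ ∈ K → a ∈ V ∩ V′ →
                    Σ[ W ∈ Subset ] Σ[ D ∈ Subset ]
                    W ∈ K × D ∈ K × a ∉ W × a ∈ D × D ⊆ (V ∩ V′) ∪ W
        S4        : ∀ (Y : Subset) 𝒥 → Y ∈ 𝒞 → IsYFamily Y 𝒥 →
                    (∀ A → A ∈ 𝒥 → Y ≬ ∁ A) →
                    Y ≬ (λ y → ∀ A → A ∈ 𝒥 → y ∈ ∁ A)

    record IsDuallyDirected (ℒ : Family) : Set (x ⊔ suc u) where
      field
        nonEmpty : Satisfiable ℒ
        directed : ∀ A B → A ∈ ℒ → B ∈ ℒ → ∃[ C ] C ∈ ℒ × C ⊆ A × C ⊆ B

    𝒵 : Pred (Pred X v) (suc (x ⊔ suc u) ⊔ v)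
    𝒵 Z = Σ[ ℒ ∈ Family ] ℒ ⊆ K × IsDuallyDirected ℒ × Z ≐ ⋂ᶠ ℒ

    L : Pred X v → Pred Subset (suc (x ⊔ suc u) ⊔ v)
    L A Z = Z ∈ 𝒵 × Z ≬ A

    -- A multirelation R ⊆ X × 𝒵(X) is a relation between points and subsets
    -- that only relates points to members of 𝒵.
    m : REL X Subset w → Pred X v → Pred X (suc (x ⊔ suc u) ⊔ v ⊔ w)
    m R A y = R y ⊆ L A

  □ : Rel X w → Pred X v → Pred X (x ⊔ v ⊔ w)
  □ T A y = T y ⊆ A

  record IsMeetRelation (K : Family) (T : Rel X u) : Set (x ⊔ suc u) where
    field
      □-closed : ∀ (A : Subset) → A ∈ S K → □ T A ∈ S K
      T-closed : ∀ y → T y ≐ ⋂ᶠ (λ A → A ∈ S K × T y ⊆ A)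

record SSpace ℓ : Set (suc (suc ℓ)) where
  field
    X        : Set ℓ
  open Subbase {u = ℓ} X
  field
    K        : Family
    isSSpace : IsSSpace K
  open IsSSpace isSSpace public

record MoSSpace ℓ : Set (suc (suc ℓ)) where
  field
    sspace : SSpace ℓ
  open SSpace sspace public
  open Subbase {u = ℓ} X
  field
    T              : Rel X ℓ
    isMeetRelation : IsMeetRelation K T
  open IsMeetRelation isMeetRelation public

module IrreducibleFilters {c e} (𝐀 : BoundedMeetSemilattice c e) where

  open BoundedMeetSemilattice 𝐀
  open import Relation.Binary.Bundles using (Poset)
  open Poset (SemilatticeProperties.poset semilattice) using (_≤_)

  record IsFilter (F : Pred Carrier c) : Set (c ⊔ e) where
    field
      ⊤∈       : ⊤ ∈ F
      up       : ∀ {a b} → a ≤ b → a ∈ F → b ∈ F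
      ∧-closed : ∀ {a b} → a ∈ F → b ∈ F → a ∧ b ∈ F

  record IsIrreducible (F : Pred Carrier c) : Set (suc c ⊔ e) where
    field
      isFilter    : IsFilter F
      proper      : ¬ Universal F
      irreducible : ∀ F₁ F₂ → IsFilter F₁ → IsFilter F₂ →
                    F ≐ F₁ ∩ F₂ → F ≐ F₁ ⊎ F ≐ F₂

  record 𝒳 : Set (suc c ⊔ e) where
    field
      set           : Pred Carrier c
      isIrreducible : IsIrreducible set

  open 𝒳 using (set)

  -- Points of 𝒳 are compared by their underlying sets, ignoring proofs.
  _≈ˣ_ : Rel 𝒳 c
  P ≈ˣ Q = set P ≐ set Q

  β : Carrier → Pred 𝒳 c
  β a P = a ∈ set P

  open Subbase {u = c} 𝒳

  K𝐀 : Family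
  K𝐀 V = ∃[ a ] V ≐ ∁ (β a)

  I : Subset → Pred Carrier (suc c ⊔ e)
  I Z a = Empty (β a ∩ Z)

  -- Intended for monotone f; monotonicity plays no role in the definition.
  R : (Carrier → Carrier) → REL 𝒳 Subset (suc (suc c ⊔ e))
  R f P Z = Z ∈ 𝒵 K𝐀 × Empty ((f ⊢ set P) ∩ I Z)

  N : (Carrier → Carrier) → Rel 𝒳 c
  N f P Q = (f ⊢ set P) ⊆ set Q

module _ {ℓ} (𝐗 : SSpace ℓ) where

  open SSpace 𝐗
  open Subbase {u = ℓ} X

  private
    U∈S : U {ℓ = ℓ} ∈ S K
    U∈S = ∅ , ∅∈K , (λ _ ()) , _

    ∩-closed : ∀ {A B : Subset} → A ∈ S K → B ∈ S K → A ∩ B ∈ S K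
    ∩-closed (V , V∈K , A⊆ , A⊇) (W , W∈K , B⊆ , B⊇) =
      V ∪ W , ∪-closed V W V∈K W∈K ,
      (λ (a , b) → [ A⊆ a , B⊆ b ]′) ,
      (λ n → A⊇ (n ∘ inj₁) , B⊇ (n ∘ inj₂))

  𝐒 : BoundedMeetSemilattice (suc ℓ) ℓ
  𝐒 = record
    { Carrier = Σ[ A ∈ Subset ] A ∈ S K
    ; _≈_     = _≐_ on proj₁
    ; _∧_     = λ (A , a) (B , b) → A ∩ B , ∩-closed a b
    ; ⊤       = U , U∈S
    ; isBoundedMeetSemilattice = record
      { isCommutativeMonoid = record
        { isMonoid = record
          { isSemigroup = record
            { isMagma = record
              { isEquivalence = On.isEquivalence proj₁ ≐-isEquivalence
              ; ∙-cong = λ (f , f′) (g , g′) →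
                  (λ (a , b) → f a , g b) , (λ (a , b) → f′ a , g′ b)
              }
            ; assoc = λ _ _ _ →
                (λ ((a , b) , c) → a , b , c) , (λ (a , b , c) → (a , b) , c)
            }
          ; identity = (λ _ → proj₂ , (λ a → _ , a)) , (λ _ → proj₁ , (λ a → a , _))
          }
        ; comm = λ _ _ → (λ (a , b) → b , a) , (λ (a , b) → b , a)
        }
      ; idem = λ _ → proj₁ , (λ a → a , a)
      }
    }

  open BoundedMeetSemilattice 𝐒 using (Carrier)
  open IrreducibleFilters 𝐒 renaming (R to R𝐒; N to N𝐒)

  -- The theory is classical; here em is used to show that the filters
  -- Hset y are irreducible.
  module Duality (em : ∀ {a} → ExcludedMiddle a) where

    Hset : X → Pred Carrier (suc ℓ)
    Hset y (A , _) = Lift (suc ℓ) (y ∈ A)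

    private
      Hset-isFilter : ∀ y → IsFilter (Hset y)
      Hset-isFilter y = record
        { ⊤∈       = _
        ; up       = λ (a≤b , _) (lift p) → lift (proj₂ (a≤b p))
        ; ∧-closed = λ (lift p) (lift q) → lift (p , q)
        }

      Hset-proper : ∀ y → ¬ Universal (Hset y)
      Hset-proper y all with covers y
      ... | V , V∈K , y∈V = lower (all (∁ V , V , V∈K , id , id)) y∈V

      Hset-irreducible : ∀ y F₁ F₂ → IsFilter F₁ → IsFilter F₂ →
                         Hset y ≐ F₁ ∩ F₂ → Hset y ≐ F₁ ⊎ Hset y ≐ F₂
      Hset-irreducible y F₁ F₂ f₁ f₂ (H⊆ , ⊆H)
        with em {P = ∃[ A ] A ∈ F₁ × A ∉ Hset y} | em {P = ∃[ B ] B ∈ F₂ × B ∉ Hset y}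
      ... | no ¬A | _ = inj₁ (proj₁ ∘ H⊆ , λ {A} a → decidable-stable em λ ∉H → ¬A (A , a , ∉H))
      ... | yes _ | no ¬B = inj₂ (proj₂ ∘ H⊆ , λ {B} b → decidable-stable em λ ∉H → ¬B (B , b , ∉H))
      ... | yes ((A , V , V∈K , A⊆ , A⊇) , A∈F₁ , A∉H)
          | yes ((B , V′ , V′∈K , B⊆ , B⊇) , B∈F₂ , B∉H)
          with S3 V V′ V∈K V′∈K
                 ( decidable-stable em (λ n → A∉H (lift (A⊇ n)))
                 , decidable-stable em (λ n → B∉H (lift (B⊇ n))))
      ... | W , D , W∈K , D∈K , y∉W , y∈D , D⊆ =
            contradiction y∈D (lower (⊆H (C∈ f₁ A∈F₁ (proj₁ H∈F) A∩H⊆C , C∈ f₂ B∈F₂ (proj₂ H∈F) B∩H⊆C)))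
        where
        H C : Carrier
        H = ∁ W , W , W∈K , id , id
        C = ∁ D , D , D∈K , id , id

        H∈F : H ∈ F₁ ∩ F₂
        H∈F = H⊆ (lift y∉W)

        A∩H⊆C : A ∩ ∁ W ⊆ ∁ D
        A∩H⊆C (a , ∉W) d = [ (λ (v , _) → A⊆ a v) , ∉W ]′ (D⊆ d)

        B∩H⊆C : B ∩ ∁ W ⊆ ∁ D
        B∩H⊆C (b , ∉W) d = [ (λ (_ , v) → B⊆ b v) , ∉W ]′ (D⊆ d)

        C∈ : ∀ {F E} → IsFilter F → E ∈ F → H ∈ F → proj₁ E ∩ ∁ W ⊆ ∁ D → C ∈ F
        C∈ f E∈F h sub = IsFilter.up f ((λ p → p , sub p) , proj₁) (IsFilter.∧-closed f E∈F h)

    H : X → 𝒳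
    H y = record
      { set           = Hset y
      ; isIrreducible = record
        { isFilter    = Hset-isFilter y
        ; proper      = Hset-proper y
        ; irreducible = Hset-irreducible y
        }
      }

    -- The direct image of Z, closed under ≈ˣ.
    H[_] : Subset → Pred 𝒳 (suc ℓ)
    H[ Z ] P = ∃[ z ] z ∈ Z × H z ≈ˣ P

    □-map : ∀ {T} → IsMeetRelation K T → Carrier → Carrier
    □-map {T} t (A , A∈S) = □ T A , IsMeetRelation.□-closed t A A∈S

    R[_] : ∀ {T} → IsMeetRelation K T → REL X Subset (suc (suc (suc ℓ)))
    R[ t ] y Z = Z ∈ 𝒵 K × R𝐒 (□-map t) (H y) H[ Z ]

    MClosed : REL X Subset w → Set (suc (suc ℓ) ⊔ w)
    MClosed R = ∀ (A : Subset) → A ∈ S K → m K R A ∈ S K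

    -- m K R A lives in a larger universe than the elements of 𝐒, so it is
    -- represented by the ≐-equal complement of a member of K.
    m-map : (R : REL X Subset w) → MClosed R → Carrier → Carrier
    m-map R closed (A , A∈S) =
      let V , V∈K , _ = closed A A∈S in ∁ V , V , V∈K , id , id

    T[_,_] : (R : REL X Subset w) → MClosed R → Rel X (suc ℓ)
    T[ R , closed ] y z = N𝐒 (m-map R closed) (H y) (H z)

{-# OPTIONS --safe #-}
-- Both parts reduce to □_T ≐ m_{R_T}.  The non-trivial inclusion: if T(y) ⊈ A,
-- then Z = Aᶜ ∈ K misses A but meets every B ∈ S(X) with T(y) ⊆ B, since
-- Z ∩ B = ∅ would give T(y) ⊆ B ⊆ A.  For (y , Z) ∈ R_T one also needs
-- H[Z] ∈ 𝒵, which holds because H is onto, so that H[Aᶜ] = β(A)ᶜ.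
-- Surjectivity of H is where S4 and compactness enter: S4 is applied to
-- Y = ⋂ P and 𝒥 = S(X) ∖ P for an irreducible filter P.
module Submission where

open import Defs
open import Algebra.Lattice.Bundles using (module BoundedMeetSemilattice)
open import Axiom.ExcludedMiddle using (ExcludedMiddle)
open import Data.List.Base using ([]; _∷_)
open import Data.List.Relation.Unary.All using (All; []; _∷_)
open import Data.List.Relation.Unary.Any using (here; there)
open import Data.Product.Base using (_×_; _,_; ∃-syntax; Σ-syntax; proj₁; proj₂)
open import Data.Sum.Base using ([_,_]′)
open import Function.Base using (_∘_; id)
open import Level using (Level; Lift; lift; lower)
open import Relation.Binary.Core using (_⇔_)
open import Relation.Binary.PropositionalEquality.Core using (_≡_; refl)
open import Relation.Nullary.Decidable.Core using (True; toWitness; fromWitness; decidable-stable)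
open import Relation.Nullary.Negation.Core using (¬_)
open import Relation.Unary
  using (Pred; _∈_; _∉_; _⊆_; _≐_; _∩_; ∁; _≬_)
open import Relation.Unary.Properties using (≐-trans)

module _ {x u : Level} {X : Set x} where

  open Subbase {u = u} X

  K⊆Open : ∀ {K V} → V ∈ K → Open K V
  K⊆Open {V = V} V∈K y∈V = V ∷ [] , V∈K ∷ [] , y∈V ∷ [] , λ { (p ∷ []) → p }

  -- The singleton family `V ≡_` is dually directed with intersection `V`.
  K⊆𝒵 : ∀ {K V} → V ∈ K → 𝒵 K V
  K⊆𝒵 {V = V} V∈K =
    (V ≡_) , (λ { refl → V∈K }) ,
    record
      { nonEmpty = V , refl
      ; directed = λ { _ _ refl refl → V , refl , id , id }
      } ,
    (λ { p _ refl → p }) , (λ p → p V refl)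

module _ (em : ∀ {a} → ExcludedMiddle a) {ℓ} (𝐗 : SSpace ℓ) where

  open SSpace 𝐗
  open Subbase {u = ℓ} X
  open IrreducibleFilters (𝐒 𝐗)
  open Duality 𝐗 em
  open BoundedMeetSemilattice (𝐒 𝐗) using (Carrier; _∧_)

  private
    co : ∀ {V} → V ∈ K → Carrier
    co {V} V∈K = ∁ V , V , V∈K , id , id

    -- S4 wants Y at level ℓ, whereas ⋂ᶠ raises the level.
    resize : ∀ {a} → Pred X a → Subset
    resize P y = Lift ℓ (True (em {P = P y}))

    resize-≐ : ∀ {a} (P : Pred X a) → resize P ≐ P
    resize-≐ _ = (λ (lift p) → toWitness p) , (λ p → lift (fromWitness p))

  module _ {F : Pred Carrier _} (isFilter : IsFilter F) where

    open IsFilter isFilter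

    up-⊆ : ∀ {A B : Carrier} → proj₁ A ⊆ proj₁ B → A ∈ F → B ∈ F
    up-⊆ A⊆B = up ((λ p → p , A⊆B p) , proj₁)

    -- The filter generated by `F` and `A`.
    adjoin : Carrier → Pred Carrier _
    adjoin A C = Σ[ B ∈ Carrier ] B ∈ F × proj₁ A ∩ proj₁ B ⊆ proj₁ C

    adjoin-isFilter : ∀ A → IsFilter (adjoin A)
    adjoin-isFilter A = record
      { ⊤∈       = _ , ⊤∈ , _
      ; up       = λ (a≤b , _) (B , B∈F , sub) → B , B∈F , (proj₂ ∘ a≤b ∘ sub)
      ; ∧-closed = λ (_ , B∈F , sub) (_ , B′∈F , sub′) →
          _ , ∧-closed B∈F B′∈F ,
          (λ (a , b , b′) → sub (a , b) , sub′ (a , b′))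
      }

    F⊆adjoin : ∀ A → F ⊆ adjoin A
    F⊆adjoin A {B} B∈F = B , B∈F , proj₂

    ∈adjoin : ∀ A → A ∈ adjoin A
    ∈adjoin A = _ , ⊤∈ , proj₁

    -- `F` is a predicate on sets paired with a proof of `A ∈ S K`. Since filters are upward closed,
    -- which proof is chosen here does not matter.
    members : Family
    members A = Σ[ A∈S ∈ A ∈ S K ] (A , A∈S) ∈ F

    nonMembers : Family
    nonMembers A = Σ[ A∈S ∈ A ∈ S K ] (A , A∈S) ∉ F

    private
      coMembers : Family
      coMembers V = Σ[ V∈K ∈ V ∈ K ] co V∈K ∈ F

      -- `D` is the meet of the complements of the `Vs`, a finite meet of members of `F`.
      member-disjoint : ∀ {Vs} → All (_∈ coMembers) Vs →
                        Σ[ D ∈ Carrier ] D ∈ F × (∀ {y} → y ∈ proj₁ D → ¬ (y ∈ ⋃ˡ Vs))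
      member-disjoint [] = _ , ⊤∈ , λ _ ()
      member-disjoint ((_ , coV∈F) ∷ Vs∈) with member-disjoint Vs∈
      ... | D , D∈F , disjoint = _ , ∧-closed coV∈F D∈F , λ where
        (y∉V , _) (here y∈V)    → y∉V y∈V
        (_ , y∈D) (there y∈Vs) → disjoint y∈D y∈Vs

    -- Otherwise the complements of members of `F` cover the compact set `V`, the complement of `A`.
    -- A finite subcover yields a member `D` of `F` missing `V`, so `D ⊆ A` and `A` lies in `F`.
    ⋂-separates : ∀ A → A ∈ nonMembers → ⋂ᶠ members ≬ ∁ A
    ⋂-separates A ((V , V∈K , A⊆ , A⊇) , A∉F) = decidable-stable em λ empty →
      let
        covered : V ⊆ ⋃ᶠ coMembers
        -- An uncovered point of `V` lies in every member of `F` but not in `A`.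
        covered y∈V = decidable-stable em λ uncovered → empty
          ( _
          , (λ { B (B∈S@(W , W∈K , B⊆ , B⊇) , B∈F) →
                 B⊇ λ y∈W → uncovered (W , (W∈K , up-⊆ {B = co W∈K} B⊆ B∈F) , y∈W) })
          , λ y∈A → A⊆ y∈A y∈V)
        Vs , Vs∈ , V⊆Vs =
          K-compact V V∈K coMembers (λ O O∈ → K⊆Open (proj₁ O∈)) covered
        D , D∈F , disjoint = member-disjoint Vs∈
      in A∉F (up-⊆ (λ y∈D → A⊇ λ y∈V → disjoint y∈D (V⊆Vs y∈V)) D∈F)

  H-surjective : ∀ P → ∃[ y ] H y ≈ˣ P
  H-surjective P = y , (λ {A} → H⊆P {A}) , (λ {A} → P⊆H {A})
    where
    open 𝒳 P renaming (set to F)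
    open IsIrreducible isIrreducible

    Y : Subset
    Y = resize (⋂ᶠ (members isFilter))

    Y≐⋂ : Y ≐ ⋂ᶠ (members isFilter)
    Y≐⋂ = resize-≐ (⋂ᶠ (members isFilter))

    isYFamily : IsYFamily K Y (nonMembers isFilter)
    isYFamily = record
      { ⊆S       = proj₁
      ; nonEmpty = decidable-stable em λ empty →
          proper λ (A , A∈S) → decidable-stable em λ A∉F → empty (A , A∈S , A∉F)
      ; directed = directed
      }
      where
      Bound : Subset → Subset → Set _
      Bound A B = Σ[ H ∈ Subset ] Σ[ C ∈ Subset ]
        H ∈ S K × C ∈ nonMembers isFilter × Y ⊆ H × A ∩ H ⊆ C × B ∩ H ⊆ C

      -- A set outside `F` in both `adjoin a` and `adjoin b` gives a bound. If there is none, `F` is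
      -- the intersection of these two filters, so by irreducibility equals one of them and contains
      -- `a` or `b`.
      directed : ∀ A B → A ∈ nonMembers isFilter → B ∈ nonMembers isFilter → Bound A B
      directed A B (A∈S , A∉F) (B∈S , B∉F) = decidable-stable em λ none →
        [ (λ (_ , ⊇) → A∉F (⊇ {a} (∈adjoin isFilter a)))
        , (λ (_ , ⊇) → B∉F (⊇ {b} (∈adjoin isFilter b)))
        ]′ (irreducible _ _ (adjoin-isFilter isFilter a) (adjoin-isFilter isFilter b)
             ( (λ {C} C∈F → F⊆adjoin isFilter a {C} C∈F , F⊆adjoin isFilter b {C} C∈F)
             , (λ {C} C∈∩ → decidable-stable em λ C∉F → none (bound C C∈∩ C∉F))))
        where
        a b : Carrier
        a = A , A∈S
        b = B , B∈S

        bound : ∀ C → C ∈ adjoin isFilter a ∩ adjoin isFilter b → C ∉ F → Bound A B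
        bound (C , C∈S) ((H₁ , H₁∈F , sub₁) , (H₂ , H₂∈F , sub₂)) C∉F =
          -- The meet of `H₁` and `H₂` is in `F`, so it contains `Y`.
          proj₁ (H₁ ∧ H₂) , C , proj₂ (H₁ ∧ H₂) , (C∈S , C∉F) ,
          (λ y∈Y → proj₁ Y≐⋂ y∈Y _ (_ , IsFilter.∧-closed isFilter {H₁} {H₂} H₁∈F H₂∈F)) ,
          (λ (p , h₁ , _) → sub₁ (p , h₁)) ,
          (λ (p , _ , h₂) → sub₂ (p , h₂))

    point : Y ≬ (λ y → ∀ A → A ∈ nonMembers isFilter → y ∈ ∁ A)
    point = S4 Y (nonMembers isFilter) (members isFilter , proj₁ , Y≐⋂) isYFamily λ A A∉F →
      let z , z∈⋂ , z∉A = ⋂-separates isFilter A A∉F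
      in z , proj₂ Y≐⋂ z∈⋂ , z∉A

    y = proj₁ point

    H⊆P : Hset y ⊆ F
    H⊆P {A , A∈S} (lift y∈A) = decidable-stable em λ A∉F →
      proj₂ (proj₂ point) A (A∈S , A∉F) y∈A

    P⊆H : F ⊆ Hset y
    P⊆H {A , A∈S} A∈F = lift (proj₁ Y≐⋂ (proj₁ (proj₂ point)) A (A∈S , A∈F))

  -- A filter `P` omitting `∁ V` is some `H y` by surjectivity, and then `y ∈ V`.
  H[]-∈K𝐀 : ∀ {V} → V ∈ K → H[ V ] ∈ K𝐀
  H[]-∈K𝐀 V∈K =
    co V∈K ,
    (λ (_ , z∈V , _ , P⊆H) ∁V∈P → lower (P⊆H {co V∈K} ∁V∈P) z∈V) ,
    (λ {P} ∁V∉P → let y , H⊆P , P⊆H = H-surjective P in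
      y , decidable-stable em (λ y∉V → ∁V∉P (H⊆P {co V∈K} (lift y∉V))) ,
      (λ {A} → H⊆P {A}) , (λ {A} → P⊆H {A}))

module _ (em : ∀ {a} → ExcludedMiddle a) {ℓ} (𝐗 : MoSSpace ℓ) where

  open MoSSpace 𝐗
  open Subbase {u = ℓ} X
  open Duality sspace em

  m-R≐□ : ∀ (A : Subset) → A ∈ S K → m K R[ isMeetRelation ] A ≐ □ T A
  m-R≐□ A A∈S@(V , V∈K , A⊆ , A⊇) = m⊆□ , □⊆m
    where
    □⊆m : □ T A ⊆ m K R[ isMeetRelation ] A
    □⊆m Ty⊆A (Z∈𝒵 , _ , meets) = Z∈𝒵 , decidable-stable em λ disjoint →
      -- If `Z` misses `A`, then `A` lies in the ideal of `H[ Z ]` while `□ T A` lies in `H y`.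
      meets (A , A∈S) (lift Ty⊆A , λ P (A∈P , z , z∈Z , _ , P⊆H) →
        disjoint (z , z∈Z , lower (P⊆H {A , A∈S} A∈P)))

    m⊆□ : m K R[ isMeetRelation ] A ⊆ □ T A
    m⊆□ {y} y∈m = decidable-stable em λ Ty⊈A →
      let
        _ , z , z∈V , z∈A = y∈m {V}
          ( K⊆𝒵 V∈K
          , K⊆𝒵 (H[]-∈K𝐀 em sspace V∈K)
          -- If `B` misses `V`, a point `t` of `T y` cannot be in `V`, since `H t` would lie in both
          -- `β B` and `H[ V ]`.
          , λ (B , B∈S) (lift Ty⊆B , disjoint) → Ty⊈A λ {t} Tyt → A⊇ λ t∈V →
              disjoint (H t) (lift (Ty⊆B Tyt) , t , t∈V , id , id))
      in A⊆ z∈A z∈V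

lemma4p5 : (em : ∀ {a} → ExcludedMiddle a) →
    ∀ {ℓ} (𝐗 : MoSSpace ℓ) →
    let open MoSSpace 𝐗
        open Subbase {u = ℓ} X
        open Duality sspace em
    in
    (Σ[ closed ∈ MClosed R[ isMeetRelation ] ]
      T ⇔ T[ R[ isMeetRelation ] , closed ])
    ×
    (∀ (A : Pred X ℓ) → A ∈ S K → m K R[ isMeetRelation ] A ≐ □ T A)
lemma4p5 em {ℓ} 𝐗 = (closed , T⊆T[R] , T[R]⊆T) , m≐□
  where
  open MoSSpace 𝐗
  open Subbase {u = ℓ} X
  open Duality sspace em

  m≐□ = m-R≐□ em 𝐗

  closed : MClosed R[ isMeetRelation ]
  closed A A∈S =
    -- Reusing the `V` that witnesses `□ T A ∈ S K` makes `m-map` return `∁ V` for this same `V`, so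
    -- `□≐∁V` applies to it directly below.
    let V , V∈K , □≐∁V = □-closed A A∈S
    in V , V∈K , ≐-trans (m≐□ A A∈S) □≐∁V

  T⊆T[R] : ∀ {y z} → T y z → T[ R[ isMeetRelation ] , closed ] y z
  T⊆T[R] Tyz {A , A∈S} (lift y∉V) =
    let _ , _ , _ , ∁V⊆□ = □-closed A A∈S
    in lift (∁V⊆□ y∉V Tyz)

  T[R]⊆T : ∀ {y z} → T[ R[ isMeetRelation ] , closed ] y z → T y z
  T[R]⊆T {y} N = proj₂ (T-closed y) λ A (A∈S , Ty⊆A) →
    let _ , _ , □⊆∁V , _ = □-closed A A∈S
    in lower (N {A , A∈S} (lift (□⊆∁V Ty⊆A)))
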